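{- There is a left-to-right fully-online collection of $K$ texts of total length $N$ for which explicitly maintaining leaf ownerships (of the suffix tree of the collection) requires $\Omega\!\left(\frac{N^2}{K}\right)$ time.
   Context: Collection: $K$ texts $\$_1S_1,\dots,\$_KS_K$, each $S_k$ initially empty and each text beginning with its own distinct marker $\$_k$. An update operator $(k,a)$, with $a$ a character, appends $a$ to the $k$th text, i.e. replaces $\$_kS_k$ by $\$_kS_ka$ (left-to-right growth). Fully-online: the sequence of update operators is arbitrary, with no restriction on the order of the text ids $k$. Suffix tree: the compacted trie of all suffixes of all texts in the collection, updated after every update operator. Nodes are identified with the strings they represent. A leaf can represent a suffix of several texts. The suffix link of a node $cv$ ($c$ a character) leads to $v$. The active point of a text is the locus in the suffix tree of the longest suffix of that text which occurs at least twice in the texts of the collection. Leaf ownership: each leaf has an owner, which is one of the texts that the leaf represents a suffix of; it is either the text that created the leaf, or the last text whose active point has extended the leaf. Here, if the active point of the $k$th text lies on a leaf $s$ when the operator $(k,a)$ is processed, then $s$ and the further leaves reached from $s$ by following suffix links are extended by $a$ (a leaf $t$ becomes the leaf $ta$), and the $k$th text becomes the owner of all these leaves. Explicitly maintaining leaf ownerships means storing the current owner with each leaf (its incoming edge label being represented by the id of the owner and a beginning position in that text) and updating it whenever the ownership is taken over. -}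

module Defs where

open import Data.Fin using (Fin)
open import Data.List using (List; []; _∷_; [_]; _∷ʳ_; drop; length; sum; tabulate; tails)
open import Data.List.Membership.Propositional using (_∈_)
open import Data.List.Relation.Binary.Pointwise using (Pointwise-≡⇒≡)
open import Data.List.Relation.Binary.Prefix.Heterogeneous using (Prefix)
open import Data.List.Relation.Binary.Suffix.Heterogeneous using (Suffix; here; there; tail)
open import Data.List.Relation.Unary.Any using (here; there)
open import Data.Nat using (ℕ; _+_; _≤_)
open import Data.Product using (Σ; ∃; ∃₂; _×_; _,_)
open import Data.Vec.Functional using (Vector; updateAt)
open import Relation.Binary.Construct.Closure.ReflexiveTransitive using (Star; ε; _◅_)
open import Relation.Binary.PropositionalEquality using (_≡_; _≢_; refl; sym)
open import Relation.Nullary using (¬_)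

-- The characters form an unbounded ordered alphabet, represented by ℕ;
-- the markers are pairwise distinct and are not characters.
data Symbol (K : ℕ) : Set where
  $_   : Fin K → Symbol K
  char : ℕ → Symbol K

String : ℕ → Set
String K = List (Symbol K)

Collection : ℕ → Set
Collection K = Vector (String K) K

totalLength : ∀ {K} → Collection K → ℕ
totalLength T = sum (tabulate λ k → length (T k))

-- The update operator (k , a) appends the character a to the k-th text.
Update : ℕ → Set
Update K = Fin K × ℕ

-- Sequences of updates are listed with the most recent one first.
texts : ∀ {K} → List (Update K) → Collection K
texts []             k = [ $ k ]
texts ((k , a) ∷ us)   = updateAt (texts us) k (_∷ʳ char a)

module _ {K : ℕ} (T : Collection K) where

  IsSuffixOf : String K → Fin K → Set
  IsSuffixOf s k = Suffix _≡_ s (T k)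

  -- The strings spelled from the root of the trie of all suffixes: the
  -- explicit nodes of the suffix tree and the positions inside its edges.
  Locus : String K → Set
  Locus w = ∃₂ λ k s → IsSuffixOf s k × Prefix _≡_ w s

  -- Compaction only suppresses nodes with exactly one child, so the leaves of
  -- the suffix tree are the childless nodes of the trie.
  Leaf : String K → Set
  Leaf s = Locus s × (∀ x → ¬ Locus (s ∷ʳ x))

  -- The suffix link of s leads to t, and t is again a leaf.
  LeafLink : String K → String K → Set
  LeafLink s t = (∃ λ c → s ≡ c ∷ t) × Leaf t

  OccursAt : String K → Fin K × ℕ → Set
  OccursAt w (k , i) = i ≤ length (T k) × Prefix _≡_ w (drop i (T k))

  OccursTwice : String K → Set
  OccursTwice w = ∃₂ λ p q → p ≢ q × OccursAt w p × OccursAt w q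

  ActivePoint : Fin K → String K → Set
  ActivePoint k w =
    IsSuffixOf w k × OccursTwice w ×
    (∀ v → IsSuffixOf v k → OccursTwice v → length v ≤ length w)

  -- The leaves that the active point of the k-th text extends when the next
  -- character is appended to that text.
  ExtendedByActivePoint : Fin K → String K → Set
  ExtendedByActivePoint k t =
    ∃ λ s → ActivePoint k s × Leaf s × Star LeafLink s t

-- Owner us u j : after the updates us, the leaf u is owned by the j-th text.
data Owner {K : ℕ} : List (Update K) → String K → Fin K → Set where

  initial : ∀ {k} → Owner [] [ $ k ] k

  created : ∀ {us k a u} →
    IsSuffixOf (texts us) u k →
    ¬ Leaf (texts us) u →
    ¬ Locus (texts us) (u ∷ʳ char a) →
    Owner ((k , a) ∷ us) (u ∷ʳ char a) k

  -- The edge label of a leaf owned by k is a suffix of the k-th text, so it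
  -- grows together with that text.
  grown : ∀ {us k a t} →
    IsSuffixOf (texts us) t k →
    Owner us t k →
    Owner ((k , a) ∷ us) (t ∷ʳ char a) k

  takenOver : ∀ {us k a t} →
    ExtendedByActivePoint (texts us) k t →
    Owner ((k , a) ∷ us) (t ∷ʳ char a) k

  kept : ∀ {us k a u j} →
    Owner us u j →
    Leaf (texts ((k , a) ∷ us)) u →
    Owner ((k , a) ∷ us) u j

-- The next update to the k-th text changes the owner of the leaf t.
OwnerChanges : ∀ {K} → List (Update K) → Fin K → String K → Set
OwnerChanges us k t =
  ExtendedByActivePoint (texts us) k t × (∃ λ j → Owner us t j × j ≢ k)

-- A way of explicitly maintaining the owners stored with the leaves: on each
-- update (k , a), a list of leaves (named by their strings before the update)
-- whose stored owner is overwritten with k.  Every leaf whose owner changes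
-- has to be among them.
data Maintenance {K : ℕ} : List (Update K) → Set where
  []     : Maintenance []
  update : ∀ {us} (k : Fin K) (a : ℕ) (writes : List (String K)) →
    (∀ t → OwnerChanges us k t → t ∈ writes) →
    Maintenance us →
    Maintenance ((k , a) ∷ us)

-- Each overwriting takes one unit of time.  Nothing else is charged, in
-- particular not the storing of the owners of newly created leaves; so lower
-- bounds on this quantity are lower bounds on the total time.
time : ∀ {K} {us : List (Update K)} → Maintenance us → ℕ
time []                    = 0
time (update _ _ writes _ m) = length writes + time m

-- Maintenances always exist: overwrite the owners of all suffixes.
suffix∈tails : ∀ {A : Set} {s t : List A} → Suffix _≡_ s t → s ∈ tails t
suffix∈tails {t = []}    (here s≡t) = here (Pointwise-≡⇒≡ s≡t)
suffix∈tails {t = _ ∷ _} (here s≡t) = here (Pointwise-≡⇒≡ s≡t)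
suffix∈tails             (there s)  = there (suffix∈tails s)

chain⇒suffix : ∀ {K} (T : Collection K) {k s t} →
  IsSuffixOf T s k → Star (LeafLink T) s t → IsSuffixOf T t k
chain⇒suffix T p ε                         = p
chain⇒suffix T p (((_ , refl) , _) ◅ links) = chain⇒suffix T (tail p) links

maintenance : ∀ {K} (us : List (Update K)) → Maintenance us
maintenance []             = []
maintenance ((k , a) ∷ us) = update k a (tails (texts us k))
  (λ { t ((s , (p , _) , _ , links) , _) →
       suffix∈tails (chain⇒suffix (texts us) p links) })
  (maintenance us)

module Submission where

-- Two of the K texts already suffice, and they give a quadratic lower bound.
-- In round r both of them receive the new character r, so that afterwards they
-- agree except for their markers and every non-empty suffix of 0 1 … r is a
-- leaf.  The text that moves first in a round extends all r leaves of the
-- preceding round and becomes their owner; letting the two texts take turns in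
-- moving first changes the owner of all these leaves in every round.

open import Defs
open import Data.Fin using (Fin; zero; suc; toℕ)
open import Data.Fin.Properties using (injective⇒≤; toℕ-injective; toℕ<n; _≟_)
open import Data.List using (List; []; _∷_; [_]; _++_; _∷ʳ_; drop; length; replicate; tabulate)
open import Data.List.Membership.Propositional using (_∈_)
open import Data.List.Properties using (length-++; length-++-comm; length-replicate)
import Data.List.Relation.Binary.Pointwise as Pointwise
open import Data.List.Relation.Binary.Prefix.Heterogeneous using (Prefix; []; _∷_)
import Data.List.Relation.Binary.Prefix.Heterogeneous.Properties as Prefix
open import Data.List.Relation.Binary.Suffix.Heterogeneous using (Suffix; here; there)
import Data.List.Relation.Binary.Suffix.Heterogeneous.Properties as Suffix
open import Data.List.Relation.Unary.Any using (index)
open import Data.List.Membership.Setoid.Properties using (index-injective)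
open import Data.Nat using (ℕ; zero; suc; _+_; _*_; _∸_; _≤_; _<_; z≤n; s≤s; z<s;
  _/_; _%_; >-nonZero)
open import Data.Nat.ListAction using (sum)
open import Data.Nat.DivMod using (m≡m%n+[m/n]*n; m%n<n)
open import Data.Nat.Properties hiding (_≟_)
open import Data.Nat.Tactic.RingSolver using (solve-∀)
open import Data.Product using (Σ; ∃; _×_; _,_; proj₂)
open import Data.Vec.Functional using (Vector; tail; updateAt)
open import Data.Vec.Functional.Properties using (updateAt-updates; updateAt-minimal)
open import Relation.Binary.Construct.Closure.ReflexiveTransitive using (Star; ε; _◅_)
open import Relation.Binary.PropositionalEquality hiding ([_])
open import Relation.Nullary using (¬_; yes; no; contradiction)

private variable
  K r : ℕ
  T   : Collection K
  p q : Fin K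

-- Runs of consecutive characters

run : ℕ → ℕ → String K
run i zero    = []
run i (suc n) = char i ∷ run (suc i) n

run-∷ʳ : ∀ i n → run {K} i (suc n) ≡ run i n ∷ʳ char (i + n)
run-∷ʳ i zero    = cong (λ j → [ char j ]) (sym (+-identityʳ i))
run-∷ʳ i (suc n) = cong (char i ∷_)
  (trans (run-∷ʳ (suc i) n) (cong (λ j → run (suc i) n ∷ʳ char j) (sym (+-suc i n))))

length-run : ∀ i n → length (run {K} i n) ≡ n
length-run i zero    = refl
length-run i (suc n) = cong suc (length-run (suc i) n)

$∉drop-run : ∀ {v : String K} k j i n → ¬ Prefix _≡_ ($ k ∷ v) (drop j (run i n))
$∉drop-run k zero    i zero    ()
$∉drop-run k zero    i (suc n) (() ∷ _)
$∉drop-run k (suc j) i zero    ()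
$∉drop-run k (suc j) i (suc n) pre = $∉drop-run k j (suc i) n pre

-- In a text $ₖ 0 1 2 … every symbol occurs at the position given by its rank.
rank : Symbol K → ℕ
rank ($ _)    = 0
rank (char a) = suc a

rank+suffix-run : ∀ {x : Symbol K} {s} i n → Suffix _≡_ (x ∷ s) (run i n) →
  rank x + length (x ∷ s) ≡ suc (i + n)
rank+suffix-run i zero    (here ())
rank+suffix-run i (suc n) (here (refl Pointwise.∷ eq)) =
  cong (λ m → suc (i + suc m)) (trans (Pointwise.Pointwise-length eq) (length-run (suc i) n))
rank+suffix-run i (suc n) (there suf) =
  trans (rank+suffix-run (suc i) n suf) (cong suc (sym (+-suc i n)))

Text : Fin K → ℕ → String K
Text k n = $ k ∷ run 0 n

-- The symbols of a text are distinct, so the first symbol of a suffix fixes where it starts and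
-- hence how long it is.
rank+suffix-Text : ∀ {x : Symbol K} {s} k n → Suffix _≡_ (x ∷ s) (Text k n) →
  rank x + length (x ∷ s) ≡ suc n
rank+suffix-Text k n (here (refl Pointwise.∷ eq)) =
  cong suc (trans (Pointwise.Pointwise-length eq) (length-run 0 n))
rank+suffix-Text k n (there suf) = rank+suffix-run 0 n suf

Text-∷ʳ : ∀ (k : Fin K) n → Text k n ∷ʳ char n ≡ Text k (suc n)
Text-∷ʳ k n = cong ($ k ∷_) (sym (run-∷ʳ 0 n))

run-suffix : ∀ i n m → Suffix _≡_ (run {K} (i + m) n) (run i (m + n))
run-suffix i n zero    rewrite +-identityʳ i = here (Pointwise.refl refl)
run-suffix i n (suc m) rewrite +-suc i m     = there (run-suffix (suc i) n m)

-- Loci, leaves and active points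

-- Only an upper bound is imposed: within a round the two moving texts differ in length, and all
-- others stay bare markers.
Bounded : Collection K → ℕ → Set
Bounded T r = ∀ k → ∃ λ n → n ≤ r × T k ≡ Text k n

Bounded-append : Bounded T r → T p ≡ Text p r →
  Bounded (updateAt T p (_∷ʳ char r)) (suc r)
Bounded-append {T = T} {r = r} {p = p} b eq k with k ≟ p
... | yes refl = suc r , ≤-refl ,
  trans (updateAt-updates p T) (trans (cong (_∷ʳ char r) eq) (Text-∷ʳ p r))
... | no k≢p with b k
...   | n , n≤r , eqₖ = n , m≤n⇒m≤1+n n≤r , trans (updateAt-minimal k p T k≢p) eqₖ

-- A locus is a prefix of a suffix with the same first symbol, whose length `rank` determines. This
-- is the tool for excluding loci.
rank+locus : ∀ {x v} → Bounded T r → Locus T (x ∷ v) → rank x + length (x ∷ v) ≤ suc r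
rank+locus b (k , (x ∷ s) , suf , pre@(refl ∷ _)) with b k
... | n , n≤r , eq rewrite eq = ≤-trans (+-monoʳ-≤ (rank x) (Prefix.length-mono pre))
  (≤-trans (≤-reflexive (rank+suffix-Text k n suf)) (s≤s n≤r))

run-IsSuffixOf : ∀ i n → i + n ≡ r → T p ≡ Text p r → IsSuffixOf T (run i n) p
run-IsSuffixOf i n refl eq rewrite eq = there (run-suffix 0 n i)

-- The run already reaches the end of the longest texts, so one more symbol would violate
-- `rank+locus`.
run-Leaf : ∀ i {n} → 0 < n → Bounded T r → T p ≡ Text p r → i + n ≡ r → Leaf T (run i n)
run-Leaf {T = T} {r = r} {p = p} i {suc n} _ b eq i+n≡r =
  (p , _ , run-IsSuffixOf {T = T} i (suc n) i+n≡r eq , Prefix.fromPointwise (Pointwise.refl refl)) ,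
  λ x locus → 1+n≰n (subst (_≤ suc r) (len x) (rank+locus b locus))
  where
  open ≡-Reasoning
  len : ∀ x → suc i + length (run i (suc n) ∷ʳ x) ≡ suc (suc r)
  len x = begin
    suc i + length (run i (suc n) ∷ʳ x)   ≡⟨ cong (suc i +_) (length-++-comm (run i (suc n)) [ x ]) ⟩
    suc i + suc (length (run i (suc n)))  ≡⟨ cong (λ m → suc i + suc m) (length-run i (suc n)) ⟩
    suc i + suc (suc n)                   ≡⟨ +-suc (suc i) (suc n) ⟩
    suc (suc (i + suc n))                 ≡⟨ cong (λ m → suc (suc m)) i+n≡r ⟩
    suc (suc r)                           ∎

run-links : ∀ i {n} m → 0 < n → Bounded T r → T p ≡ Text p r → i + (m + n) ≡ r →
  Star (LeafLink T) (run i (m + n)) (run (i + m) n)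
run-links i zero 0<n b eq i+n≡r rewrite +-identityʳ i = ε
run-links {p = p} i {n} (suc m) 0<n b eq i+n≡r rewrite +-suc i m | +-suc i (m + n) =
  ((_ , refl) , run-Leaf {p = p} (suc i) (≤-trans 0<n (m≤n+m n m)) b eq i+n≡r) ◅
  run-links {p = p} (suc i) m 0<n b eq i+n≡r

$-occursAt : ∀ {v k i} → Bounded T r → OccursAt T ($ p ∷ v) (k , i) → (k , i) ≡ (p , 0)
$-occursAt {k = k} b (_ , pre) with b k
$-occursAt {i = zero} b (_ , pre) | n , _ , eq rewrite eq with refl ∷ _ ← pre = refl
$-occursAt {p = p} {i = suc i} b (_ , pre) | n , _ , eq rewrite eq =
  contradiction pre ($∉drop-run p i 0 n)

-- The run follows both markers, so it occurs twice. The only longer suffix is the whole text, whose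
-- marker occurs just once.
run-ActivePoint : p ≢ q → Bounded T r → T p ≡ Text p r → T q ≡ Text q r →
  ActivePoint T p (run 0 r)
run-ActivePoint {p = p} {q = q} {T = T} {r = r} p≢q b eq-p eq-q =
  run-IsSuffixOf {T = T} 0 r refl eq-p ,
  ((p , 1) , (q , 1) , (λ { refl → p≢q refl }) , occurs eq-p , occurs eq-q) ,
  maximal
  where
  occurs : ∀ {k} → T k ≡ Text k r → OccursAt T (run 0 r) (k , 1)
  occurs eq rewrite eq = s≤s z≤n , Prefix.fromPointwise (Pointwise.refl refl)

  maximal : ∀ v → IsSuffixOf T v p → OccursTwice T v → length v ≤ length (run 0 r)
  maximal v suf twice with subst (Suffix _≡_ v) eq-p suf
  ... | there suf′ = Suffix.length-mono suf′
  ... | here (refl Pointwise.∷ _) with _ , _ , x≢y , at-x , at-y ← twice =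
    contradiction (trans ($-occursAt b at-x) (sym ($-occursAt b at-y))) x≢y

-- Alternating rounds and leaf ownership

-- The state between two rounds: p moves first in the next round, and q moved
-- first in the last one.
record Balanced (us : List (Update K)) (p q : Fin K) (r : ℕ) : Set where
  field
    first   : texts us p ≡ Text p r
    second  : texts us q ≡ Text q r
    bounded : Bounded (texts us) r
    owned   : ∀ i n → 0 < n → i + n ≡ r → Owner us (run i n) q

open Balanced

run-extended : ∀ {us : List (Update K)} → p ≢ q → Balanced us p q r → ∀ i {n} → 0 < n → i + n ≡ r →
  ExtendedByActivePoint (texts us) p (run i n)
run-extended {p = p} p≢q bal i {n} 0<n refl =
  run 0 (i + n) ,
  run-ActivePoint p≢q (bounded bal) (first bal) (second bal) ,
  run-Leaf {p = p} 0 (≤-trans 0<n (m≤n+m n i)) (bounded bal) (first bal) refl ,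
  run-links {p = p} 0 i 0<n (bounded bal) (first bal) refl

round : Fin K → Fin K → ℕ → List (Update K) → List (Update K)
round p q r us = (q , r) ∷ (p , r) ∷ us

-- The last round is opened by `q`, so that `p` opens the next one; swapping the arguments in the
-- recursion makes them alternate.
rounds : Fin K → Fin K → ℕ → List (Update K)
rounds p q zero    = []
rounds p q (suc r) = round q p r (rounds q p r)

-- The move of `p` takes over every old leaf and creates the leaf of the new character. These
-- strings are still leaves after the move of `q`, so `kept` preserves their owner.
round-Balanced : ∀ {us : List (Update K)} → p ≢ q → Balanced us p q r →
  Balanced (round p q r us) q p (suc r)
round-Balanced {p = p} {q = q} {r = r} {us = us} p≢q bal = record
  { first   = first′
  ; second  = second′
  ; bounded = bounded′
  ; owned   = λ i n 0<n i+n≡r →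
      kept (owned′ i n 0<n i+n≡r) (run-Leaf {p = p} i 0<n bounded′ second′ i+n≡r)
  }
  where
  us₁ us₂ : List (Update _)
  us₁ = (p , r) ∷ us
  us₂ = (q , r) ∷ us₁

  text-q₁ : texts us₁ q ≡ Text q r
  text-q₁ = trans (updateAt-minimal q p (texts us) (≢-sym p≢q)) (second bal)

  first′ : texts us₂ q ≡ Text q (suc r)
  first′ = trans (updateAt-updates q (texts us₁)) (trans (cong (_∷ʳ char r) text-q₁) (Text-∷ʳ q r))

  second′ : texts us₂ p ≡ Text p (suc r)
  second′ = trans (updateAt-minimal p q (texts us₁) p≢q)
    (trans (updateAt-updates p (texts us)) (trans (cong (_∷ʳ char r) (first bal)) (Text-∷ʳ p r)))

  bounded₁ : Bounded (texts us₁) (suc r)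
  bounded₁ = Bounded-append (bounded bal) (first bal)

  bounded′ : Bounded (texts us₂) (suc r)
  bounded′ k with k ≟ q
  ... | yes refl = suc r , ≤-refl , first′
  ... | no k≢q with bounded₁ k
  ...   | n , n≤ , eq = n , n≤ , trans (updateAt-minimal k q (texts us₁) k≢q) eq

  owned′ : ∀ i n → 0 < n → i + n ≡ suc r → Owner us₁ (run i n) p
  owned′ i (suc zero) _ i+n≡r with refl ← suc-injective (trans (+-comm 1 i) i+n≡r) =
    -- The one-character leaf is attached to the root, which is no leaf because `$ p` hangs below
    -- it; the character is fresh by `rank+locus`.
    created {u = []}
      (run-IsSuffixOf {T = texts us} i 0 (+-identityʳ i) (first bal))
      (λ leaf → proj₂ leaf ($ p) (p , _ , here (Pointwise.refl refl) ,
        subst (Prefix _≡_ [ $ p ]) (sym (first bal)) (refl ∷ [])))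
      (λ locus → 1+n≰n (subst (_≤ suc i) (+-comm (suc i) 1) (rank+locus (bounded bal) locus)))
  owned′ i (suc (suc n)) _ i+n≡r
    with i+n≡r′ ← suc-injective (trans (sym (+-suc i (suc n))) i+n≡r) =
    subst (λ u → Owner us₁ u p)
      (trans (cong (λ a → run i (suc n) ∷ʳ char a) (sym i+n≡r′)) (sym (run-∷ʳ i (suc n))))
      (takenOver (run-extended p≢q bal i z<s i+n≡r′))

rounds-Balanced : ∀ {p q : Fin K} r → p ≢ q → Balanced (rounds p q r) p q r
rounds-Balanced zero p≢q = record
  { first   = refl
  ; second  = refl
  ; bounded = λ k → 0 , z≤n , refl
  ; owned   = λ { zero .(suc _) (s≤s z≤n) () ; (suc i) n 0<n () }
  }
rounds-Balanced (suc r) p≢q = round-Balanced (≢-sym p≢q) (rounds-Balanced r (≢-sym p≢q))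

-- Counting the ownership changes

-- The r leaves 0 … (r − 1), 1 … (r − 1), … are told apart by their lengths.
round-writes : ∀ {us : List (Update K)} {writes} → p ≢ q → Balanced us p q r →
  (∀ t → OwnerChanges us p t → t ∈ writes) → r ≤ length writes
round-writes {q = q} {r = r} {us = us} {writes = writes} p≢q bal complete =
  -- Equal positions in `writes` hold equal leaves, so positions inject `Fin r` into the list.
  injective⇒≤ {f = λ j → index (written j)} λ {j} {j′} eq →
    toℕ-injective (suc-injective (begin
      suc (toℕ j)            ≡⟨ length-run (start j) (suc (toℕ j)) ⟨
      length (leaf j)        ≡⟨ cong length (index-injective (setoid _) (written j) (written j′) eq) ⟩
      length (leaf j′)       ≡⟨ length-run (start j′) (suc (toℕ j′)) ⟩
      suc (toℕ j′)           ∎))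
  where
  open ≡-Reasoning
  start : Fin r → ℕ
  start j = r ∸ suc (toℕ j)

  leaf : Fin r → String _
  leaf j = run (start j) (suc (toℕ j))

  written : ∀ j → leaf j ∈ writes
  written j = complete (leaf j)
    ( run-extended p≢q bal (start j) z<s start+length
    , q , owned bal (start j) _ z<s start+length , ≢-sym p≢q)
    where
    start+length : start j + suc (toℕ j) ≡ r
    start+length = m∸n+n≡m (toℕ<n j)

-- The first moves cost at least 0 + 1 + ... + (r - 1) = r (r - 1) / 2; this form avoids subtraction
-- and division.
rounds-time : ∀ r → p ≢ q → (m : Maintenance (rounds p q r)) → r * r ≤ 2 * time m + r
rounds-time zero p≢q m = z≤n
rounds-time (suc r) p≢q (update _ _ ws′ _ (update _ _ ws complete m)) = begin
  suc r * suc r                                         ≡⟨ lhs r ⟩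
  r * r + (2 * r + 1)                                   ≤⟨ +-mono-≤ (rounds-time r (≢-sym p≢q) m)
                                                             (+-monoˡ-≤ 1 (*-monoʳ-≤ 2 r≤)) ⟩
  2 * time m + r + (2 * length ws + 1)                  ≤⟨ m≤m+n _ (2 * length ws′) ⟩
  2 * time m + r + (2 * length ws + 1) + 2 * length ws′ ≡⟨ rhs (time m) r (length ws) (length ws′) ⟩
  2 * (length ws′ + (length ws + time m)) + suc r       ∎
  where
  open ≤-Reasoning
  r≤ : r ≤ length ws
  r≤ = round-writes (≢-sym p≢q) (rounds-Balanced r (≢-sym p≢q)) complete
  lhs : ∀ r → suc r * suc r ≡ r * r + (2 * r + 1)
  lhs = solve-∀
  rhs : ∀ t r w w′ → 2 * t + r + (2 * w + 1) + 2 * w′ ≡ 2 * (w′ + (w + t)) + suc r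
  rhs = solve-∀

-- The newest updates come first, so dropping `vs` forgets the end of the history and only removes
-- writes.
time-++ : ∀ vs {us : List (Update K)} (m : Maintenance (vs ++ us)) →
  ∃ λ (m′ : Maintenance us) → time m′ ≤ time m
time-++ []       m = m , ≤-refl
time-++ (_ ∷ vs) (update _ _ ws _ m) with m′ , m′≤m ← time-++ vs m =
  m′ , ≤-trans m′≤m (m≤n+m _ (length ws))

-- Total length

length-rounds : ∀ (p q : Fin K) r → length (rounds p q r) ≡ r * 2
length-rounds p q zero    = refl
length-rounds p q (suc r) = cong (2 +_) (length-rounds q p r)

sum-length-append : ∀ {A : Set} {n} (T : Vector (List A) n) k x →
  sum (tabulate λ j → length (updateAt T k (_∷ʳ x) j)) ≡ suc (sum (tabulate λ j → length (T j)))
sum-length-append T zero    x =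
  cong (_+ sum (tabulate λ j → length (tail T j))) (length-++-comm (T zero) [ x ])
sum-length-append T (suc k) x =
  trans (cong (length (T zero) +_) (sum-length-append (tail T) k x)) (+-suc _ _)

totalLength-texts : ∀ (us : List (Update K)) → totalLength (texts us) ≡ K + length us
totalLength-texts {K} [] = trans (initially K) (sym (+-identityʳ K))
  where
  initially : ∀ n → sum (tabulate {n = n} (λ _ → 1)) ≡ n
  initially zero    = refl
  initially (suc n) = cong suc (initially n)
totalLength-texts {K} ((k , a) ∷ us) =
  trans (sum-length-append (texts us) k (char a))
    (trans (cong suc (totalLength-texts us)) (sym (+-suc K (length us))))

-- Arithmetic and the final collection

-- With M = N ∸ K ≥ 2 K updates there are R = M / 2 ≥ 2 rounds, so that
-- N ≤ 2 M ≤ 6 R and R ² ≤ 4 t, where t is the time.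
N²≤144Kt : ∀ {K M R b t} → 2 ≤ K → 2 * K ≤ M → b < 2 → M ≡ b + R * 2 →
  R * R ≤ 2 * t + R → (K + M) * (K + M) ≤ 144 * (K * t)
N²≤144Kt {K} {M} {R} {b} {t} 2≤K 2K≤M b<2 M≡ R²≤ = begin
  (K + M) * (K + M)   ≤⟨ *-mono-≤ N≤6R N≤6R ⟩
  (6 * R) * (6 * R)   ≡⟨ square R ⟩
  36 * (R * R)        ≤⟨ *-monoʳ-≤ 36 R²≤4t ⟩
  36 * (4 * t)        ≡⟨ *-assoc 36 4 t ⟨
  -- The bound obtained so far is quadratic in N; the positive factor `K` merely weakens it to the
  -- claimed form.
  144 * t             ≤⟨ *-monoʳ-≤ 144 (m≤n*m t K {{>-nonZero (≤-trans z<s 2≤K)}}) ⟩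
  144 * (K * t)       ∎
  where
  open ≤-Reasoning
  square : ∀ R → (6 * R) * (6 * R) ≡ 36 * (R * R)
  square = solve-∀

  M≤1+2R : M ≤ 1 + R * 2
  M≤1+2R = ≤-trans (≤-reflexive M≡) (+-monoˡ-≤ (R * 2) (≤-pred b<2))

  2≤R : 2 ≤ R
  -- At least 4 updates are available, while `R ≤ 1` would allow at most 3.
  2≤R = ≮⇒≥ λ R<2 → 1+n≰n (begin
    4            ≤⟨ *-monoʳ-≤ 2 2≤K ⟩
    2 * K        ≤⟨ 2K≤M ⟩
    M            ≤⟨ M≤1+2R ⟩
    1 + R * 2    ≤⟨ +-monoʳ-≤ 1 (*-monoˡ-≤ 2 (≤-pred R<2)) ⟩
    3            ∎)

  N≤6R : K + M ≤ 6 * R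
  N≤6R = begin
    K + M            ≤⟨ +-monoˡ-≤ M (≤-trans (m≤n*m K 2) 2K≤M) ⟩
    M + M            ≤⟨ +-mono-≤ M≤3R M≤3R ⟩
    3 * R + 3 * R    ≡⟨ *-distribʳ-+ R 3 3 ⟨
    6 * R            ∎
    where
    M≤3R : M ≤ 3 * R
    M≤3R = begin
      M            ≤⟨ M≤1+2R ⟩
      1 + R * 2    ≤⟨ +-monoˡ-≤ (R * 2) (≤-trans (s≤s z≤n) 2≤R) ⟩
      R + R * 2    ≡⟨ cong (R +_) (*-comm R 2) ⟩
      3 * R        ∎

  R²≤4t : R * R ≤ 4 * t
  R²≤4t = +-cancelʳ-≤ (R * R) (R * R) (4 * t) (begin
    R * R + R * R              ≤⟨ +-mono-≤ R²≤ R²≤ ⟩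
    2 * t + R + (2 * t + R)    ≡⟨ double t R ⟩
    -- Since `2 ≤ R`, the square absorbs the linear term and then cancels.
    4 * t + 2 * R              ≤⟨ +-monoʳ-≤ (4 * t) (*-monoˡ-≤ R 2≤R) ⟩
    4 * t + R * R              ∎)
    where
    double : ∀ t R → 2 * t + R + (2 * t + R) ≡ 4 * t + 2 * R
    double = solve-∀

lemma7 : Σ ℕ λ C → Σ ℕ λ B →
    (K N : ℕ) → 2 ≤ K → B * K ≤ N →
    Σ (List (Update K)) λ us →
    (totalLength (texts us) ≡ N) ×
    ((m : Maintenance us) → N * N ≤ C * (K * time m))
-- The constant 144 is 36 · 4, from N ≤ 6 R and R² ≤ 4 t; with `3 * K ≤ N`, removing the `K` markers
-- leaves at least `2 * K` updates.
lemma7 = 144 , 3 , construction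
  where
  construction : (K N : ℕ) → 2 ≤ K → 3 * K ≤ N →
    Σ (List (Update K)) λ us →
    (totalLength (texts us) ≡ N) ×
    ((m : Maintenance us) → N * N ≤ 144 * (K * time m))
  construction 1 N (s≤s ())
  construction K@(suc (suc _)) N 2≤K 3K≤N
    with M , refl ← m≤n⇒∃[o]m+o≡n (≤-trans (m≤n*m K 3) 3K≤N) =
    us , trans (totalLength-texts us) (cong (K +_) length-us) , bound
    where
    b R : ℕ
    b = M % 2
    R = M / 2

    us : List (Update K)
    -- An odd `M` is met by one padding update after all rounds, which `time-++` discards.
    us = replicate b (zero , 0) ++ rounds zero (suc zero) R

    length-us : length us ≡ M
    length-us = trans (length-++ (replicate b (zero , 0)))
      (trans (cong₂ _+_ (length-replicate b) (length-rounds zero (suc zero) R))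
        (sym (m≡m%n+[m/n]*n M 2)))

    bound : (m : Maintenance us) → (K + M) * (K + M) ≤ 144 * (K * time m)
    bound m with m′ , m′≤m ← time-++ (replicate b (zero , 0)) m =
      N²≤144Kt {R = R} {t = time m} 2≤K (+-cancelˡ-≤ K (2 * K) M 3K≤N)
        (m%n<n M 2) (m≡m%n+[m/n]*n M 2)
        (≤-trans (rounds-time R (λ ()) m′) (+-monoˡ-≤ R (*-monoʳ-≤ 2 m′≤m)))
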